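{- For every integer $n \geq 5$, the geodesic path number of the wheel graph $W_n$ is $$t_{gp}(W_n) = \frac{(n-1)(n+2)}{2}.$$
   Context: The wheel graph on $n$ vertices, $W_n$, is the cycle $C_{n-1}$ on $n-1$ vertices together with one additional vertex adjacent to all the vertices of $C_{n-1}$. A geodesic path in a graph $G$ is a path with at least one edge which is a shortest path in $G$ between its two end vertices; paths are undirected (a path and its reversal are the same path). The geodesic path number $t_{gp}(G)$ is the total number of geodesic paths in $G$. -}

module Defs where

open import Data.Empty using (⊥)
open import Data.Fin using (Fin; zero; suc; toℕ)
open import Data.List using (List; []; _∷_; reverse)
open import Data.List.Properties using (reverse-involutive)
open import Data.List.Relation.Unary.Unique.Propositional using (Unique)
open import Data.Nat using (ℕ; zero; suc; _≤_; z≤n; s≤s; s≤s⁻¹)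
open import Data.Nat.Properties using (1+n≢n)
open import Data.Product using (_×_; _,_)
open import Data.Sum using (_⊎_; inj₁; inj₂; swap)
open import Data.Unit using (⊤; tt)
open import Function.Bundles using (Bijection)
open import Level using (0ℓ)
open import Relation.Binary.Bundles using (Setoid)
open import Relation.Binary.Construct.Closure.ReflexiveTransitive using (Star; ε; _◅_)
open import Relation.Binary.Core using (Rel)
open import Relation.Binary.Definitions using (Symmetric; Irreflexive)
open import Relation.Binary.PropositionalEquality
  using (_≡_; refl; sym; trans; cong; setoid)

record SimpleGraph (n : ℕ) : Set₁ where
  field
    Adj    : Rel (Fin n) 0ℓ
    symm   : Symmetric Adj
    irrefl : Irreflexive _≡_ Adj

-- j is the cyclic successor of i, i.e. j = i + 1 modulo m.
data Next {m : ℕ} (i j : Fin m) : Set where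
  step : toℕ j ≡ suc (toℕ i) → Next i j
  wrap : suc (toℕ i) ≡ m → toℕ j ≡ 0 → Next i j

Next-irrefl : ∀ {m} → 3 ≤ m → {i : Fin m} → Next i i → ⊥
Next-irrefl _ (step eq) = 1+n≢n (sym eq)
Next-irrefl (s≤s (s≤s _)) (wrap eq i≡0) with trans (sym (cong suc i≡0)) eq
... | ()

cycle : (m : ℕ) → 3 ≤ m → SimpleGraph m
cycle m 3≤m = record
  { Adj    = λ i j → Next i j ⊎ Next j i
  ; symm   = swap
  ; irrefl = λ { refl (inj₁ s) → Next-irrefl 3≤m s
               ; refl (inj₂ s) → Next-irrefl 3≤m s }
  }

-- The added vertex is zero; vertex i of G becomes suc i.
module _ {m : ℕ} (G : SimpleGraph m) where
  private module G = SimpleGraph G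

  ConeAdj : Rel (Fin (suc m)) 0ℓ
  ConeAdj zero    zero    = ⊥
  ConeAdj zero    (suc j) = ⊤
  ConeAdj (suc i) zero    = ⊤
  ConeAdj (suc i) (suc j) = G.Adj i j

  ConeAdj-sym : Symmetric ConeAdj
  ConeAdj-sym {zero}  {suc j} _ = tt
  ConeAdj-sym {suc i} {zero}  _ = tt
  ConeAdj-sym {suc i} {suc j} a = G.symm a

  ConeAdj-irrefl : Irreflexive _≡_ ConeAdj
  ConeAdj-irrefl {suc i} refl a = G.irrefl refl a

  cone : SimpleGraph (suc m)
  cone = record { Adj = ConeAdj ; symm = λ {i} {j} → ConeAdj-sym {i} {j} ; irrefl = ConeAdj-irrefl }

wheel : (n : ℕ) → 4 ≤ n → SimpleGraph n
wheel (suc m) 4≤n = cone (cycle m (s≤s⁻¹ 4≤n))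

module _ {n : ℕ} (G : SimpleGraph n) where
  open SimpleGraph G

  Walk : Fin n → Fin n → Set
  Walk = Star Adj

  vertices : ∀ {u v} → Walk u v → List (Fin n)
  vertices {u} ε       = u ∷ []
  vertices {u} (_ ◅ w) = u ∷ vertices w

  walkLength : ∀ {u v} → Walk u v → ℕ
  walkLength ε       = 0
  walkLength (_ ◅ w) = suc (walkLength w)

  record Path (u v : Fin n) : Set where
    field
      walk     : Walk u v
      distinct : Unique (vertices walk)

    length : ℕ
    length = walkLength walk

  IsShortest : ∀ {u v} → Path u v → Set
  IsShortest {u} {v} p = (q : Path u v) → Path.length p ≤ Path.length q

  record GeodesicPath : Set where
    field
      {source target} : Fin n
      path            : Path source target
      nontrivial      : 1 ≤ Path.length path
      shortest        : IsShortest path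

    vertexList : List (Fin n)
    vertexList = vertices (Path.walk path)

  open GeodesicPath using (vertexList)

  -- In a simple graph a path is determined by its vertex sequence, and an
  -- undirected path by its vertex sequence up to reversal.
  _≈ₚ_ : Rel GeodesicPath 0ℓ
  p ≈ₚ q = vertexList p ≡ vertexList q ⊎ vertexList p ≡ reverse (vertexList q)

  private
    flip-reverse : ∀ {xs ys : List (Fin n)} → xs ≡ reverse ys → ys ≡ reverse xs
    flip-reverse {ys = ys} eq = trans (sym (reverse-involutive ys)) (cong reverse (sym eq))

    ≈ₚ-sym : ∀ {p q} → p ≈ₚ q → q ≈ₚ p
    ≈ₚ-sym (inj₁ eq) = inj₁ (sym eq)
    ≈ₚ-sym (inj₂ eq) = inj₂ (flip-reverse eq)

    ≈ₚ-trans : ∀ {p q r} → p ≈ₚ q → q ≈ₚ r → p ≈ₚ r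
    ≈ₚ-trans (inj₁ a) (inj₁ b) = inj₁ (trans a b)
    ≈ₚ-trans (inj₁ a) (inj₂ b) = inj₂ (trans a b)
    ≈ₚ-trans (inj₂ a) (inj₁ b) = inj₂ (trans a (cong reverse b))
    ≈ₚ-trans (inj₂ a) (inj₂ b) = inj₁ (trans a (sym (flip-reverse b)))

  geodesicPaths : Setoid 0ℓ 0ℓ
  geodesicPaths = record
    { Carrier       = GeodesicPath
    ; _≈_           = _≈ₚ_
    ; isEquivalence = record
      { refl  = inj₁ refl
      ; sym   = λ {p} {q} → ≈ₚ-sym {p} {q}
      ; trans = λ {p} {q} {r} → ≈ₚ-trans {p} {q} {r}
      }
    }

-- "t_gp(G) = k": there are exactly k geodesic paths, a path and its reversal
-- being counted once.
GeodesicPathNumber : ∀ {n} → SimpleGraph n → ℕ → Set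
GeodesicPathNumber G k = Bijection (setoid (Fin k)) (geodesicPaths G)

{-# OPTIONS --safe #-}
-- In a cone any two distinct vertices are joined by exactly one geodesic that is
-- either an edge or passes through the apex.  In a wheel with m ≥ 4 rim vertices
-- the only other geodesics are the m rim paths of length two, each determined by
-- its middle vertex.  This gives (m + 1)m/2 + m = m(m + 3)/2 geodesics in all.
module Submission where

open import Defs
open import Data.Empty using (⊥; ⊥-elim)
open import Data.Fin using (Fin; zero; suc; toℕ; fromℕ; fromℕ<; inject₁; _<_)
open import Data.Fin.Properties
  using (_≟_; <⇒≢; <-cmp; <-asym; toℕ<n; toℕ-injective; toℕ-fromℕ; toℕ-fromℕ<; toℕ-inject₁;
         suc-injective; 0↔⊥; +↔⊎)
open import Data.List using (List; []; _∷_; reverse)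
open import Data.List.Properties using (reverse-involutive)
open import Data.List.Relation.Unary.All using ([]; _∷_)
open import Data.List.Relation.Unary.AllPairs using ([]; _∷_)
open import Data.Nat using (ℕ; zero; suc; _+_; _*_; _∸_; _≤_; z≤n; s≤s; s≤s⁻¹; _<?_)
open import Data.Nat.DivMod using (_/_; m*n/n≡m)
import Data.Nat.Properties as ℕ
open import Data.Nat.Properties using (<⇒≤)
open import Data.Nat.Tactic.RingSolver using (solve-∀)
open import Data.Product using (∃; ∃-syntax; _×_; _,_)
open import Data.Sum using (_⊎_; inj₁; inj₂; [_,_]′)
open import Data.Sum.Function.Propositional using (_⊎-↔_)
open import Data.Unit using (tt)
open import Function.Base using (_∘_)
open import Function.Bundles using (Bijection; _↔_)
open import Function.Construct.Composition using (bijection)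
open import Function.Properties.Inverse using (↔-refl; ↔-trans; ↔⇒⤖)
open import Relation.Binary.Construct.Closure.ReflexiveTransitive using (ε; _◅_)
open import Relation.Binary.Definitions using (Decidable; tri<; tri≈; tri>)
open import Relation.Binary.PropositionalEquality
  using (_≡_; _≢_; refl; sym; trans; cong; subst; setoid; module ≡-Reasoning)
open import Relation.Nullary using (¬_; yes; no; contradiction)
open import Relation.Nullary.Decidable using (map′; _⊎-dec_)

-- Two-element subsets of a finite set

-- inj₁ j stands for {0, j + 1} and inj₂ p for the pair p with both elements shifted by one.
Pair : ℕ → Set
Pair zero    = ⊥
Pair (suc n) = Fin n ⊎ Pair n

-- The binomial coefficient n choose 2, with the same recursion as `Pair` so that the two match
-- clause by clause.
triangular : ℕ → ℕ
triangular zero    = 0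
triangular (suc n) = n + triangular n

triangular-*2 : ∀ n → triangular (suc n) * 2 ≡ n * suc n
triangular-*2 zero    = refl
triangular-*2 (suc n) = begin
  (suc n + triangular (suc n)) * 2      ≡⟨ ℕ.*-distribʳ-+ 2 (suc n) (triangular (suc n)) ⟩
  suc n * 2 + triangular (suc n) * 2    ≡⟨ cong (suc n * 2 +_) (triangular-*2 n) ⟩
  suc n * 2 + n * suc n                 ≡⟨ rearrange n ⟩
  suc n * suc (suc n)                   ∎
  where
  open ≡-Reasoning
  rearrange : ∀ k → suc k * 2 + k * suc k ≡ suc k * suc (suc k)
  rearrange = solve-∀

Fin↔Pair : ∀ n → Fin (triangular n) ↔ Pair n
Fin↔Pair zero    = 0↔⊥
Fin↔Pair (suc n) = ↔-trans (+↔⊎ {n}) (↔-refl ⊎-↔ Fin↔Pair n)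

lower upper : ∀ n → Pair n → Fin n
lower (suc n) (inj₁ j) = zero
lower (suc n) (inj₂ p) = suc (lower n p)
upper (suc n) (inj₁ j) = suc j
upper (suc n) (inj₂ p) = suc (upper n p)

lower<upper : ∀ n p → lower n p < upper n p
lower<upper (suc n) (inj₁ j) = s≤s z≤n
lower<upper (suc n) (inj₂ p) = s≤s (lower<upper n p)

lower≢upper : ∀ n p → lower n p ≢ upper n p
lower≢upper n p = <⇒≢ (lower<upper n p)

Pair-ext : ∀ n p q → lower n p ≡ lower n q → upper n p ≡ upper n q → p ≡ q
Pair-ext (suc n) (inj₁ i) (inj₁ j) _  eq = cong inj₁ (suc-injective eq)
Pair-ext (suc n) (inj₂ p) (inj₂ q) el eu =
  cong inj₂ (Pair-ext n p q (suc-injective el) (suc-injective eu))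

toPair : ∀ n {u v : Fin n} → u < v → ∃[ p ] lower n p ≡ u × upper n p ≡ v
toPair (suc n) {zero}  {suc v} _   = inj₁ v , refl , refl
toPair (suc n) {suc u} {suc v} u<v with toPair n (s≤s⁻¹ u<v)
... | p , refl , refl = inj₂ p , refl , refl

-- Short geodesics

module _ {n : ℕ} (G : SimpleGraph n) where
  open SimpleGraph G

  1≤walkLength : ∀ {u v} → u ≢ v → (w : Walk G u v) → 1 ≤ walkLength G w
  1≤walkLength u≢v ε       = contradiction refl u≢v
  1≤walkLength u≢v (_ ◅ _) = s≤s z≤n

  2≤walkLength : ∀ {u v} → u ≢ v → ¬ Adj u v → (w : Walk G u v) → 2 ≤ walkLength G w
  2≤walkLength u≢v u≁v ε           = contradiction refl u≢v
  2≤walkLength u≢v u≁v (a ◅ ε)     = contradiction a u≁v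
  2≤walkLength u≢v u≁v (_ ◅ _ ◅ _) = s≤s (s≤s z≤n)

  adj⇒≢ : ∀ {u v} → Adj u v → u ≢ v
  adj⇒≢ a eq = irrefl eq a

  edgePath : ∀ {u v} → Adj u v → Path G u v
  edgePath a = record { walk = a ◅ ε ; distinct = (adj⇒≢ a ∷ []) ∷ [] ∷ [] }

  twoStepPath : ∀ {u x v} → u ≢ v → Adj u x → Adj x v → Path G u v
  twoStepPath u≢v a b = record
    { walk     = a ◅ b ◅ ε
    ; distinct = (adj⇒≢ a ∷ u≢v ∷ []) ∷ (adj⇒≢ b ∷ []) ∷ [] ∷ []
    }

  edgeGeodesic : ∀ {u v} → Adj u v → GeodesicPath G
  edgeGeodesic a = record
    { path       = edgePath a
    ; nontrivial = s≤s z≤n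
    ; shortest   = λ q → 1≤walkLength (adj⇒≢ a) (Path.walk q)
    }

  twoStepGeodesic : ∀ {u x v} → u ≢ v → ¬ Adj u v → Adj u x → Adj x v → GeodesicPath G
  twoStepGeodesic u≢v u≁v a b = record
    { path       = twoStepPath u≢v a b
    ; nontrivial = s≤s z≤n
    ; shortest   = λ q → 2≤walkLength u≢v u≁v (Path.walk q)
    }

  -- With equal ends the one-vertex path, of length 0, would beat a path of positive length.
  source≢target : (p : GeodesicPath G) → GeodesicPath.source p ≢ GeodesicPath.target p
  source≢target record { nontrivial = pos ; shortest = short } refl
    with ℕ.≤-trans pos (short (record { walk = ε ; distinct = [] ∷ [] }))
  ... | ()

-- Geodesics of a cone

module _ {m : ℕ} (G : SimpleGraph m) where
  private C = cone G
  open SimpleGraph C using (Adj; symm)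

  -- Indexed by vertex lists, since `_≈ₚ_` compares nothing else. The constructors exclude each
  -- other through `Adj u v`, so an ordered pair of ends admits at most one list.
  data Chordal (u v : Fin (suc m)) : List (Fin (suc m)) → Set where
    edge    : Adj u v → Chordal u v (u ∷ v ∷ [])
    viaApex : ¬ Adj u v → Chordal u v (u ∷ zero ∷ v ∷ [])

  -- Candidates for geodesics of two edges avoiding the apex; for cycles they become the `Rim` paths
  -- below.
  data BasePath : List (Fin (suc m)) → Set where
    base : ∀ {i j k} → i ≢ k → SimpleGraph.Adj G i j → SimpleGraph.Adj G j k →
           BasePath (suc i ∷ suc j ∷ suc k ∷ [])

  Chordal-reverse : ∀ {u v xs} → Chordal u v xs → Chordal v u (reverse xs)
  Chordal-reverse {u} {v} (edge a)    = edge (symm {u} {v} a)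
  Chordal-reverse {u} {v} (viaApex f) = viaApex (f ∘ symm {v} {u})

  Chordal-functional : ∀ {u v xs ys} → Chordal u v xs → Chordal u v ys → xs ≡ ys
  Chordal-functional (edge _)    (edge _)    = refl
  Chordal-functional (edge a)    (viaApex f) = contradiction a f
  Chordal-functional (viaApex f) (edge a)    = contradiction a f
  Chordal-functional (viaApex _) (viaApex _) = refl

  Chordal-ends : ∀ {u v u′ v′ xs} → Chordal u v xs → Chordal u′ v′ xs → u ≡ u′ × v ≡ v′
  Chordal-ends (edge _)    (edge _)    = refl , refl
  Chordal-ends (viaApex _) (viaApex _) = refl , refl

  nonadjacent⇒adjApex : ∀ u v → u ≢ v → ¬ Adj u v → Adj u zero × Adj zero v
  nonadjacent⇒adjApex zero    zero    u≢v _   = contradiction refl u≢v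
  nonadjacent⇒adjApex zero    (suc v) _   u≁v = contradiction tt u≁v
  nonadjacent⇒adjApex (suc u) zero    _   u≁v = contradiction tt u≁v
  nonadjacent⇒adjApex (suc u) (suc v) _   _   = tt , tt

  module _ (adj? : Decidable (SimpleGraph.Adj G)) where

    coneAdj? : Decidable Adj
    coneAdj? zero    zero    = no λ ()
    coneAdj? zero    (suc _) = yes tt
    coneAdj? (suc _) zero    = yes tt
    coneAdj? (suc i) (suc j) = adj? i j

    chordWithShape : ∀ u v → u ≢ v → ∃[ p ] Chordal u v (GeodesicPath.vertexList {G = C} p)
    chordWithShape u v u≢v with coneAdj? u v
    ... | yes a  = edgeGeodesic C a , edge a
    ... | no u≁v =
      let a , b = nonadjacent⇒adjApex u v u≢v u≁v in twoStepGeodesic C u≢v u≁v a b , viaApex u≁v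

    -- A cone has diameter at most two: a detour through the apex always serves.
    path≤2 : ∀ u v → u ≢ v → ∃[ p ] Path.length {G = C} {u} {v} p ≤ 2
    path≤2 u v u≢v with coneAdj? u v
    ... | yes a  = edgePath C a , s≤s z≤n
    ... | no u≁v =
      let a , b = nonadjacent⇒adjApex u v u≢v u≁v in twoStepPath C u≢v a b , s≤s (s≤s z≤n)

    -- The diameter bound leaves one or two edges. In the second case the ends are non-adjacent,
    -- hence both in the base, and the middle vertex decides between the two shapes.
    geodesic-shape : (p : GeodesicPath C) → let open GeodesicPath p in
                     Chordal source target vertexList ⊎ BasePath vertexList
    geodesic-shape p = shape (Path.walk path) nontrivial shortest (source≢target C p)
      where
      open GeodesicPath p
      shape : ∀ {u v} (w : Walk C u v) → 1 ≤ walkLength C w →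
              (∀ q → walkLength C w ≤ Path.length {G = C} {u} {v} q) → u ≢ v →
              Chordal u v (vertices C w) ⊎ BasePath (vertices C w)
      shape ε () _ _
      shape (a ◅ ε) _ _ _ = inj₁ (edge a)
      shape {u} {v} (_◅_ {j = x} a (b ◅ ε)) _ short u≢v with coneAdj? u v
      ... | yes uv = contradiction (short (edgePath C uv)) λ { (s≤s ()) }
      shape {_}     {_}     (_◅_ {j = zero}  a (b ◅ ε)) _ _ _   | no u≁v = inj₁ (viaApex u≁v)
      shape {suc _} {suc _} (_◅_ {j = suc _} a (b ◅ ε)) _ _ u≢v | no u≁v =
        inj₂ (base (u≢v ∘ cong suc) a b)
      -- An end at the apex is impossible here: the apex is adjacent to every other vertex.
      shape {zero}  {zero}  (_◅_ {j = suc _} a (b ◅ ε)) _ _ u≢v | no u≁v = contradiction refl u≢v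
      shape {zero}  {suc _} (_◅_ {j = suc _} a (b ◅ ε)) _ _ u≢v | no u≁v = contradiction tt u≁v
      shape {suc _} {zero}  (_◅_ {j = suc _} a (b ◅ ε)) _ _ u≢v | no u≁v = contradiction tt u≁v
      shape {u} {v} (_ ◅ _ ◅ _ ◅ _) _ short u≢v with path≤2 u v u≢v
      ... | q , q≤2 = contradiction (ℕ.≤-trans (short q) q≤2) λ { (s≤s (s≤s ())) }

-- Adjacency on a cycle

module _ {m : ℕ} where

  Next-functional : {i j k : Fin m} → Next i j → Next i k → j ≡ k
  Next-functional (step p)   (step q)   = toℕ-injective (trans p (sym q))
  Next-functional {j = j} (step p) (wrap e _) = contradiction (trans p e) (ℕ.<⇒≢ (toℕ<n j))
  Next-functional {k = k} (wrap e _) (step p) = contradiction (trans p e) (ℕ.<⇒≢ (toℕ<n k))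
  Next-functional (wrap _ p) (wrap _ q) = toℕ-injective (trans p (sym q))

  Next-injective : {i j k : Fin m} → Next i k → Next j k → i ≡ j
  Next-injective (step p)   (step q)   = toℕ-injective (ℕ.suc-injective (trans (sym p) q))
  Next-injective (step p)   (wrap _ z) = contradiction (trans (sym z) p) ℕ.0≢1+n
  Next-injective (wrap _ z) (step p)   = contradiction (trans (sym z) p) ℕ.0≢1+n
  Next-injective (wrap p _) (wrap q _) = toℕ-injective (ℕ.suc-injective (trans p (sym q)))

  Next⇒≤ : {i j : Fin m} → Next i j → toℕ j ≤ suc (toℕ i)
  Next⇒≤ (step p)   = ℕ.≤-reflexive p
  Next⇒≤ (wrap _ z) = subst (_≤ _) (sym z) z≤n

successor : ∀ {m} (i : Fin m) → ∃ (Next i)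
successor {suc m} i with suc (toℕ i) <? suc m
... | yes i+1<m = fromℕ< i+1<m , step (toℕ-fromℕ< i+1<m)
... | no i+1≮m  = zero , wrap (ℕ.≤-antisym (toℕ<n i) (ℕ.≮⇒≥ i+1≮m)) refl

predecessor : ∀ {m} (i : Fin m) → ∃[ h ] Next h i
predecessor {suc m} zero    = fromℕ m , wrap (cong suc (toℕ-fromℕ m)) refl
predecessor {suc m} (suc i) = inject₁ i , step (cong suc (sym (toℕ-inject₁ i)))

-- Successors are unique, so comparing `j` with the computed successor of `i` decides the relation.
next? : ∀ {m} → Decidable (Next {m})
next? i j with successor i
... | k , i→k = map′ (λ { refl → i→k }) (Next-functional i→k) (k ≟ j)

cycleAdj? : ∀ {m} (3≤m : 3 ≤ m) → Decidable (SimpleGraph.Adj (cycle m 3≤m))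
cycleAdj? _ i j = next? i j ⊎-dec next? j i

module _ {m : ℕ} (4≤m : 4 ≤ m) where

  private
    -- A step that wraps around starts at m − 1 ≥ 3 and ends at 0, whereas two steps from 0
    -- reach at most 2.
    wrap-no-3-cycle : {i j k : Fin m} → suc (toℕ k) ≡ m → toℕ i ≡ 0 → Next i j → Next j k → ⊥
    wrap-no-3-cycle {i} {j} {k} e z i→j j→k = ℕ.<⇒≱ 4≤m (begin
      m                         ≡⟨ sym e ⟩
      suc (toℕ k)               ≤⟨ s≤s (Next⇒≤ j→k) ⟩
      2 + toℕ j                 ≤⟨ ℕ.+-monoʳ-≤ 2 (Next⇒≤ i→j) ⟩
      3 + toℕ i                 ≡⟨ cong (3 +_) z ⟩
      3                         ∎)
      where open ℕ.≤-Reasoning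

    -- One step from 0 reaches at most 1, short of m - 1.
    wrap-no-2-cycle : {i j : Fin m} → suc (toℕ j) ≡ m → toℕ i ≡ 0 → Next i j → ⊥
    wrap-no-2-cycle {i} {j} e z i→j = ℕ.<⇒≱ (ℕ.<⇒≤ 4≤m) (begin
      m                         ≡⟨ sym e ⟩
      suc (toℕ j)               ≤⟨ s≤s (Next⇒≤ i→j) ⟩
      2 + toℕ i                 ≡⟨ cong (2 +_) z ⟩
      2                         ∎)
      where open ℕ.≤-Reasoning

  -- Positions increase along every `step`, so a closed tour must wrap somewhere; rotating it puts
  -- the wrapping step last.
  no-2-cycle : {i j : Fin m} → Next i j → Next j i → ⊥
  no-2-cycle i→j (wrap e z) = wrap-no-2-cycle e z i→j
  no-2-cycle (wrap e z) j→i = wrap-no-2-cycle e z j→i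
  no-2-cycle (step p) (step q) = ℕ.m≢1+n+m _ (trans q (cong suc p))

  -- The same rotation argument. On three rim vertices such a triangle exists, whence the bound 4 ≤
  -- m.
  no-3-cycle : {i j k : Fin m} → Next i j → Next j k → Next k i → ⊥
  no-3-cycle i→j j→k (wrap e z) = wrap-no-3-cycle e z i→j j→k
  no-3-cycle i→j (wrap e z) k→i = wrap-no-3-cycle e z k→i i→j
  no-3-cycle (wrap e z) j→k k→i = wrap-no-3-cycle e z j→k k→i
  no-3-cycle (step p) (step q) (step r) =
    ℕ.m≢1+n+m _ (trans r (cong suc (trans q (cong suc p))))

-- Geodesics of a wheel

module Wheel {m : ℕ} (3≤m : 3 ≤ m) (4≤m : 4 ≤ m) where

  private
    G = cycle m 3≤m
    W = cone G
  open GeodesicPath {G = W} using (source; target; vertexList)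

  -- Vertex lists carry an orientation, so each middle vertex `j` has two lists, one the reverse of
  -- the other.
  data Rim (j : Fin m) : List (Fin (suc m)) → Set where
    forward  : ∀ {i k} → Next i j → Next j k → Rim j (suc i ∷ suc j ∷ suc k ∷ [])
    backward : ∀ {i k} → Next i j → Next j k → Rim j (suc k ∷ suc j ∷ suc i ∷ [])

  Rim-middle : ∀ {j j′ xs} → Rim j xs → Rim j′ xs → j ≡ j′
  Rim-middle (forward _ _)  (forward _ _)  = refl
  Rim-middle (forward _ _)  (backward _ _) = refl
  Rim-middle (backward _ _) (forward _ _)  = refl
  Rim-middle (backward _ _) (backward _ _) = refl

  Rim-reverse : ∀ {j xs} → Rim j xs → Rim j (reverse xs)
  Rim-reverse (forward a b)  = backward a b
  Rim-reverse (backward a b) = forward a b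

  -- Predecessor and successor of `j` are unique, so only the orientation is free.
  Rim-unique : ∀ {j xs ys} → Rim j xs → Rim j ys → xs ≡ ys ⊎ xs ≡ reverse ys
  Rim-unique (forward a b) (forward a′ b′)
    with refl ← Next-injective a a′ | refl ← Next-functional b b′ = inj₁ refl
  Rim-unique (forward a b) (backward a′ b′)
    with refl ← Next-injective a a′ | refl ← Next-functional b b′ = inj₂ refl
  Rim-unique (backward a b) (forward a′ b′)
    with refl ← Next-injective a a′ | refl ← Next-functional b b′ = inj₂ refl
  Rim-unique (backward a b) (backward a′ b′)
    with refl ← Next-injective a a′ | refl ← Next-functional b b′ = inj₁ refl

  Chordal-Rim-disjoint : ∀ {u v j xs} → Chordal G u v xs → Rim j xs → ⊥
  Chordal-Rim-disjoint (edge _)    ()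
  Chordal-Rim-disjoint (viaApex _) ()

  -- Both edges must run the same way round the cycle: opposite directions would make the two ends
  -- equal.
  BasePath⇒Rim : ∀ {xs} → BasePath G xs → ∃[ j ] Rim j xs
  BasePath⇒Rim (base _   (inj₁ a) (inj₁ b)) = _ , forward a b
  BasePath⇒Rim (base _   (inj₂ a) (inj₂ b)) = _ , backward b a
  BasePath⇒Rim (base i≢k (inj₁ a) (inj₂ b)) = contradiction (Next-injective a b) i≢k
  BasePath⇒Rim (base i≢k (inj₂ a) (inj₁ b)) = contradiction (Next-functional a b) i≢k

  rimWithShape : ∀ j → ∃[ p ] Rim j (vertexList p)
  rimWithShape j =
    let i , i→j = predecessor j
        k , j→k = successor j
        i≢k : suc i ≢ suc k
        i≢k eq = no-2-cycle 4≤m i→j (subst (Next j) (sym (suc-injective eq)) j→k)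
        i≁k : ¬ (Next i k ⊎ Next k i)
        -- An edge from `i` to `k` would force k = j and so a loop at `j`; an edge from `k` to `i`
        -- would close a triangle.
        i≁k = λ { (inj₁ i→k) → Next-irrefl 3≤m (subst (Next j) (Next-functional i→k i→j) j→k)
                ; (inj₂ k→i) → no-3-cycle 4≤m i→j j→k k→i }
    in twoStepGeodesic W i≢k i≁k (inj₁ i→j) (inj₁ j→k) , forward i→j j→k

  -- Enumeration of the geodesics of a wheel by codes

  Code : Set
  Code = Pair (suc m) ⊎ Fin m

  Shape : Code → List (Fin (suc m)) → Set
  Shape (inj₁ p) = Chordal G (lower _ p) (upper _ p)
  Shape (inj₂ j) = Rim j

  geodesicWithShape : ∀ c → ∃[ p ] Shape c (vertexList p)
  geodesicWithShape (inj₁ p) = chordWithShape G (cycleAdj? 3≤m) _ _ (lower≢upper _ p)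
  geodesicWithShape (inj₂ j) = rimWithShape j

  Shape-injective : ∀ {xs} c d → Shape c xs → Shape d xs → c ≡ d
  Shape-injective (inj₁ p) (inj₁ q) s t =
    let el , eu = Chordal-ends G s t in cong inj₁ (Pair-ext _ p q el eu)
  Shape-injective (inj₁ p) (inj₂ j) s t = ⊥-elim (Chordal-Rim-disjoint s t)
  Shape-injective (inj₂ i) (inj₁ q) s t = ⊥-elim (Chordal-Rim-disjoint t s)
  Shape-injective (inj₂ i) (inj₂ j) s t = cong inj₂ (Rim-middle s t)

  -- Handles geodesics identified by reversal. Chordal codes are oriented from lower to upper end,
  -- which a reversal would contradict; rim paths keep their middle vertex.
  Shape-injective-reverse : ∀ {xs} c d → Shape c (reverse xs) → Shape d xs → c ≡ d
  Shape-injective-reverse (inj₁ p) (inj₁ q) s t =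
    let el , eu = Chordal-ends G s (Chordal-reverse G t) in
    ⊥-elim (<-asym (lower<upper _ q)
                   (subst (upper _ q <_) eu (subst (_< upper _ p) el (lower<upper _ p))))
  Shape-injective-reverse (inj₁ p) (inj₂ j) s t = ⊥-elim (Chordal-Rim-disjoint s (Rim-reverse t))
  Shape-injective-reverse (inj₂ i) (inj₁ q) s t =
    ⊥-elim (Chordal-Rim-disjoint (Chordal-reverse G t) s)
  Shape-injective-reverse (inj₂ i) (inj₂ j) s t = cong inj₂ (Rim-middle s (Rim-reverse t))

  Shape-determines : ∀ {xs ys} c → Shape c xs → Shape c ys → xs ≡ ys ⊎ xs ≡ reverse ys
  Shape-determines (inj₁ p) s t = inj₁ (Chordal-functional G s t)
  Shape-determines (inj₂ j) s t = Rim-unique s t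

  -- Codes are oriented upwards, so a geodesic running downwards is coded through its reverse.
  chordal-code : ∀ {u v xs} → u ≢ v → Chordal G u v xs → ∃[ c ] (Shape c xs ⊎ Shape c (reverse xs))
  chordal-code {u} {v} u≢v s with <-cmp u v
  ... | tri≈ _ u≡v _ = contradiction u≡v u≢v
  ... | tri< u<v _ _ with toPair _ u<v
  ...   | p , refl , refl = inj₁ p , inj₁ s
  chordal-code u≢v s | tri> _ _ v<u with toPair _ v<u
  ...   | p , refl , refl = inj₁ p , inj₂ (Chordal-reverse G s)

  code : (p : GeodesicPath W) → ∃[ c ] (Shape c (vertexList p) ⊎ Shape c (reverse (vertexList p)))
  code p with geodesic-shape G (cycleAdj? 3≤m) p
  ... | inj₁ s = chordal-code (source≢target W p) s
  ... | inj₂ b = let j , s = BasePath⇒Rim b in inj₂ j , inj₁ s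

  geodesic : Code → GeodesicPath W
  geodesic c = let p , _ = geodesicWithShape c in p

  Shape-geodesic : ∀ c → Shape c (vertexList (geodesic c))
  Shape-geodesic c = let _ , s = geodesicWithShape c in s

  -- Injective because a vertex list, even reversed, fits only one code; surjective because every
  -- geodesic has a code and a code fixes the list up to reversal.
  geodesic-bijection : Bijection (setoid Code) (geodesicPaths W)
  geodesic-bijection = record
    { to        = geodesic
    ; cong      = λ { refl → inj₁ refl }
    ; bijective = (λ {c} {d} → injective c d) , surjective
    }
    where
    injective : ∀ c d → _≈ₚ_ W (geodesic c) (geodesic d) → c ≡ d
    injective c d (inj₁ eq) =
      Shape-injective c d (subst (Shape c) eq (Shape-geodesic c)) (Shape-geodesic d)
    injective c d (inj₂ eq) =
      Shape-injective-reverse c d (subst (Shape c) eq (Shape-geodesic c)) (Shape-geodesic d)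

    surjective : ∀ p → ∃[ c ] (∀ {d} → d ≡ c → _≈ₚ_ W (geodesic d) p)
    surjective p with code p
    ... | c , inj₁ s = c , λ { refl → Shape-determines c (Shape-geodesic c) s }
    -- The code fits the reversed list, so the two alternatives of `_≈ₚ_` trade places.
    ... | c , inj₂ s = c , λ { refl →
      [ inj₂ , (λ eq → inj₁ (trans eq (reverse-involutive (vertexList p)))) ]′
        (Shape-determines c (Shape-geodesic c) s) }

  geodesicPathNumber : GeodesicPathNumber W (triangular (suc m) + m)
  geodesicPathNumber = bijection
    (↔⇒⤖ (↔-trans (+↔⊎ {triangular (suc m)}) (Fin↔Pair (suc m) ⊎-↔ ↔-refl)))
    geodesic-bijection

-- Division on ℕ rounds down, so the identity is proved in doubled form and the factor 2 cancelled
-- afterwards.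
geodesicCount : ∀ m → triangular (suc m) + m ≡ (m * (suc m + 2)) / 2
geodesicCount m = begin
  triangular (suc m) + m                    ≡⟨ sym (m*n/n≡m _ 2) ⟩
  ((triangular (suc m) + m) * 2) / 2        ≡⟨ cong (_/ 2) doubled ⟩
  (m * (suc m + 2)) / 2                     ∎
  where
  open ≡-Reasoning
  rearrange : ∀ k → k * suc k + k * 2 ≡ k * (suc k + 2)
  rearrange = solve-∀
  doubled : (triangular (suc m) + m) * 2 ≡ m * (suc m + 2)
  doubled = begin
    (triangular (suc m) + m) * 2            ≡⟨ ℕ.*-distribʳ-+ 2 (triangular (suc m)) m ⟩
    triangular (suc m) * 2 + m * 2          ≡⟨ cong (_+ m * 2) (triangular-*2 m) ⟩
    m * suc m + m * 2                       ≡⟨ rearrange m ⟩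
    m * (suc m + 2)                         ∎

theorem3p1 : (n : ℕ) → (5≤n : 5 ≤ n) →
    GeodesicPathNumber (wheel n (<⇒≤ 5≤n)) (((n ∸ 1) * (n + 2)) / 2)
theorem3p1 (suc m) 5≤n =
  subst (GeodesicPathNumber (wheel (suc m) (<⇒≤ 5≤n))) (geodesicCount m)
        -- The first argument is the very proof of 3 ≤ m that `wheel` passes to `cycle`, so both
        -- graphs agree by definition.
        (Wheel.geodesicPathNumber (s≤s⁻¹ (<⇒≤ 5≤n)) (s≤s⁻¹ 5≤n))
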